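{- Let $N$ be a positive integer and let $w \in F_N$. Then $w \in \bar{\mathcal{A}}$ if and only if $w$ can be written as \[ w = p_1\delta_1p_2\delta_2\cdots p_n\delta_np_{n+1} \] for some $n \geq 0$ with $p_1, \ldots, p_{n+1} \in \mathcal{P}$ and $\delta_1, \ldots, \delta_n \in \mathbb{Z}/N\mathbb{Z}$. Moreover, such a factorization of $w \in \bar{\mathcal{A}}$ is unique.
   Context: $N$ is a positive integer. $F_N$ is the free monoid of all finite words with letters in $\mathbb{Z}/N\mathbb{Z}$ (identity: the empty word $\varepsilon$); juxtaposition of letters and words is concatenation. $\pi : F_N \to \mathrm{SL}_2(\mathbb{Z}/N\mathbb{Z})$ is the monoid homomorphism with $\pi(\alpha) = \begin{bmatrix} 0 & 1 \\ -1 & \alpha \end{bmatrix}$ for each letter $\alpha$, so $\pi(\alpha_1\cdots\alpha_l)=\pi(\alpha_1)\cdots\pi(\alpha_l)$ and $\pi(\varepsilon)$ is the identity matrix. On $(\mathbb{Z}/N\mathbb{Z})^2\smallsetminus\{0\}$ (column vectors) let $u\sim' v$ if and only if $u=\lambda v$ for some $\lambda\in(\mathbb{Z}/N\mathbb{Z})^\times$, the unit group of $\mathbb{Z}/N\mathbb{Z}$; $\mathrm{SL}_2(\mathbb{Z}/N\mathbb{Z})$ acts on the set of $\sim'$-classes by left multiplication. $\bar{\mathcal{A}} = \left\{w \in F_N : \pi(w)\begin{bmatrix} 0 \\ 1 \end{bmatrix} = \begin{bmatrix} 1 \\ 0 \end{bmatrix}\right\}$, where the equality is one of $\sim'$-classes,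 and $\bar{\mathcal{C}}=F_N\smallsetminus\bar{\mathcal{A}}$. $F_N^l$ is the set of words of length $l$, $\bar{\mathcal{A}}^l=F_N^l\cap\bar{\mathcal{A}}$ and $\bar{\mathcal{C}}^l=F_N^l\cap\bar{\mathcal{C}}$. Let $\mathcal{P}^l = \left\{ \alpha_1 \alpha_2 \cdots \alpha_l \in \bar{\mathcal{A}}^l : \alpha_1 \cdots \alpha_h \in \bar{\mathcal{C}}^h \text{ for } h=1, \ldots , l-1 \right\}$ and $\mathcal{P}=\bigcup_l \mathcal{P}^l$. -}

module Defs where

open import Algebra.Bundles using (CommutativeRing)
open import Algebra.Definitions using (Invertible)
open import Algebra.Structures using (IsCommutativeRing)
open import Data.Fin.Base using (Fin; toℕ)
open import Data.Fin.Properties using (toℕ-injective; toℕ-fromℕ<; toℕ<n)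
open import Data.List.Base using (List; []; _∷_; _++_; foldr; length; map; take)
open import Data.Nat.Base as ℕ using (ℕ; suc; NonZero)
open import Data.Nat.DivMod
  using (_%_; _mod_; m%n<n; m<n⇒m%n≡m; n%n≡0; %-distribˡ-+; %-distribˡ-*)
import Data.Nat.Properties as ℕ
open import Data.Product using (Σ-syntax; ∃-syntax; _×_; _,_)
open import Data.Vec.Base using (Vec; []; _∷_)
open import Data.Vec.Relation.Unary.All using (All)
open import Level using (0ℓ)
open import Relation.Binary.PropositionalEquality hiding ([_])
open import Relation.Unary using (Pred; _∈_; _∩_; ∁; ⋃)

-- The standard library has no ring ℤ/Nℤ; residues are their least
-- non-negative representatives, so that congruence is _≡_.

ℤ/_ : ℕ → Set
ℤ/ N = Fin N

module _ {N : ℕ} .{{_ : NonZero N}} where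

  infixl 6 _+_ _-_
  infixl 7 _*_
  infix  8 -_

  _+_ _*_ : ℤ/ N → ℤ/ N → ℤ/ N
  x + y = (toℕ x ℕ.+ toℕ y) mod N
  x * y = (toℕ x ℕ.* toℕ y) mod N

  -_ : ℤ/ N → ℤ/ N
  - x = (N ℕ.∸ toℕ x) mod N

  _-_ : ℤ/ N → ℤ/ N → ℤ/ N
  x - y = x + - y

  -- For N = 1 these coincide.
  0# 1# : ℤ/ N
  0# = 0 mod N
  1# = 1 mod N

  private
    [_] : ℕ → ℤ/ N
    [ m ] = m mod N

    toℕ-[] : ∀ m → toℕ [ m ] ≡ m % N
    toℕ-[] m = toℕ-fromℕ< (m%n<n m N)

    []-cong : ∀ {m n} → m % N ≡ n % N → [ m ] ≡ [ n ]
    []-cong {m} {n} eq =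
      toℕ-injective (trans (toℕ-[] m) (trans eq (sym (toℕ-[] n))))

    []-toℕ : ∀ x → [ toℕ x ] ≡ x
    []-toℕ x = toℕ-injective (trans (toℕ-[] (toℕ x)) (m<n⇒m%n≡m (toℕ<n x)))

    []-+ : ∀ m n → [ m ] + [ n ] ≡ [ m ℕ.+ n ]
    []-+ m n = trans (cong₂ (λ i j → [ i ℕ.+ j ]) (toℕ-[] m) (toℕ-[] n))
                     ([]-cong (sym (%-distribˡ-+ m n N)))

    []-* : ∀ m n → [ m ] * [ n ] ≡ [ m ℕ.* n ]
    []-* m n = trans (cong₂ (λ i j → [ i ℕ.* j ]) (toℕ-[] m) (toℕ-[] n))
                     ([]-cong (sym (%-distribˡ-* m n N)))

    []-+ˡ : ∀ m y → [ m ] + y ≡ [ m ℕ.+ toℕ y ]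
    []-+ˡ m y = trans (cong ([ m ] +_) (sym ([]-toℕ y))) ([]-+ m (toℕ y))

    []-+ʳ : ∀ x n → x + [ n ] ≡ [ toℕ x ℕ.+ n ]
    []-+ʳ x n = trans (cong (_+ [ n ]) (sym ([]-toℕ x))) ([]-+ (toℕ x) n)

    []-*ˡ : ∀ m y → [ m ] * y ≡ [ m ℕ.* toℕ y ]
    []-*ˡ m y = trans (cong ([ m ] *_) (sym ([]-toℕ y))) ([]-* m (toℕ y))

    []-*ʳ : ∀ x n → x * [ n ] ≡ [ toℕ x ℕ.* n ]
    []-*ʳ x n = trans (cong (_* [ n ]) (sym ([]-toℕ x))) ([]-* (toℕ x) n)

  +-assoc : ∀ x y z → (x + y) + z ≡ x + (y + z)
  +-assoc x y z = trans ([]-+ˡ _ z)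
    (trans (cong [_] (ℕ.+-assoc (toℕ x) (toℕ y) (toℕ z))) (sym ([]-+ʳ x _)))

  +-comm : ∀ x y → x + y ≡ y + x
  +-comm x y = cong [_] (ℕ.+-comm (toℕ x) (toℕ y))

  +-identityˡ : ∀ x → 0# + x ≡ x
  +-identityˡ x = trans ([]-+ˡ 0 x) ([]-toℕ x)

  +-identityʳ : ∀ x → x + 0# ≡ x
  +-identityʳ x = trans (+-comm x 0#) (+-identityˡ x)

  -‿inverseʳ : ∀ x → x + - x ≡ 0#
  -‿inverseʳ x = trans ([]-+ʳ x _)
    ([]-cong (trans (cong (_% N) (ℕ.m+[n∸m]≡n (ℕ.<⇒≤ (toℕ<n x))))
                    (trans (n%n≡0 N) (sym (m<n⇒m%n≡m (ℕ.>-nonZero⁻¹ N))))))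

  -‿inverseˡ : ∀ x → - x + x ≡ 0#
  -‿inverseˡ x = trans (+-comm (- x) x) (-‿inverseʳ x)

  *-assoc : ∀ x y z → (x * y) * z ≡ x * (y * z)
  *-assoc x y z = trans ([]-*ˡ _ z)
    (trans (cong [_] (ℕ.*-assoc (toℕ x) (toℕ y) (toℕ z))) (sym ([]-*ʳ x _)))

  *-comm : ∀ x y → x * y ≡ y * x
  *-comm x y = cong [_] (ℕ.*-comm (toℕ x) (toℕ y))

  *-identityˡ : ∀ x → 1# * x ≡ x
  *-identityˡ x = trans ([]-*ˡ 1 x)
    (trans (cong [_] (ℕ.*-identityˡ (toℕ x))) ([]-toℕ x))

  *-identityʳ : ∀ x → x * 1# ≡ x
  *-identityʳ x = trans (*-comm x 1#) (*-identityˡ x)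

  *-distribˡ-+ : ∀ x y z → x * (y + z) ≡ x * y + x * z
  *-distribˡ-+ x y z = trans ([]-*ʳ x _)
    (trans (cong [_] (ℕ.*-distribˡ-+ (toℕ x) (toℕ y) (toℕ z)))
           (sym ([]-+ (toℕ x ℕ.* toℕ y) (toℕ x ℕ.* toℕ z))))

  *-distribʳ-+ : ∀ x y z → (y + z) * x ≡ y * x + z * x
  *-distribʳ-+ x y z = trans (*-comm (y + z) x)
    (trans (*-distribˡ-+ x y z) (cong₂ _+_ (*-comm x y) (*-comm x z)))

  +-*-isCommutativeRing : IsCommutativeRing _≡_ _+_ _*_ (λ x → - x) 0# 1#
  +-*-isCommutativeRing = record
    { isRing = record
      { +-isAbelianGroup = record
        { isGroup = record
          { isMonoid = record
            { isSemigroup = record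
              { isMagma = record { isEquivalence = isEquivalence ; ∙-cong = cong₂ _+_ }
              ; assoc   = +-assoc
              }
            ; identity = +-identityˡ , +-identityʳ
            }
          ; inverse = -‿inverseˡ , -‿inverseʳ
          ; ⁻¹-cong = cong (λ x → - x)
          }
        ; comm = +-comm
        }
      ; *-cong     = cong₂ _*_
      ; *-assoc    = *-assoc
      ; *-identity = *-identityˡ , *-identityʳ
      ; distrib    = *-distribˡ-+ , *-distribʳ-+
      }
    ; *-comm = *-comm
    }

ℤ/-commutativeRing : (N : ℕ) .{{_ : NonZero N}} → CommutativeRing 0ℓ 0ℓ
ℤ/-commutativeRing N = record { isCommutativeRing = +-*-isCommutativeRing {N} }

record Matrix₂ (N : ℕ) : Set where
  constructor ⟦_,_︔_,_⟧
  field
    m₁₁ m₁₂ m₂₁ m₂₂ : ℤ/ N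

Vector₂ : ℕ → Set
Vector₂ N = ℤ/ N × ℤ/ N

module _ {N : ℕ} .{{_ : NonZero N}} where

  det : Matrix₂ N → ℤ/ N
  det ⟦ a , b ︔ c , d ⟧ = a * d - b * c

  infixl 7 _⊗_
  _⊗_ : Matrix₂ N → Matrix₂ N → Matrix₂ N
  ⟦ a , b ︔ c , d ⟧ ⊗ ⟦ e , f ︔ g , h ⟧ =
    ⟦ a * e + b * g , a * f + b * h ︔ c * e + d * g , c * f + d * h ⟧

  Id : Matrix₂ N
  Id = ⟦ 1# , 0# ︔ 0# , 1# ⟧

SL₂ : (N : ℕ) .{{_ : NonZero N}} → Set
SL₂ N = Σ[ M ∈ Matrix₂ N ] det M ≡ 1#

module _ {N : ℕ} .{{_ : NonZero N}} where

  private
    module R = CommutativeRing (ℤ/-commutativeRing N)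
    open import Algebra.Properties.Ring R.ring using (-1*x≈-x; -‿involutive)
    import Algebra.Solver.Ring.NaturalCoefficients.Default R.commutativeSemiring as S
    open S using (solve; con; _:+_; _:*_; _:=_)

    -- n plays the role of -1, which keeps both identities subtraction-free.
    product : ∀ n a b c d e f g h →
      (a * e + b * g) * (c * f + d * h) + n * ((a * f + b * h) * (c * e + d * g))
        ≡ (a * d * (e * h) + b * c * (f * g) + n * (a * d * (f * g) + b * c * (e * h)))
          + (1# + n) * (a * e * (c * f) + b * g * (d * h))
    product = solve 9 (λ n a b c d e f g h →
      (a :* e :+ b :* g) :* (c :* f :+ d :* h) :+ n :* ((a :* f :+ b :* h) :* (c :* e :+ d :* g))
        := (a :* d :* (e :* h) :+ b :* c :* (f :* g) :+ n :* (a :* d :* (f :* g) :+ b :* c :* (e :* h)))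
           :+ (con 1 :+ n) :* (a :* e :* (c :* f) :+ b :* g :* (d :* h))) refl

    expand : ∀ n a b c d e f g h →
      (a * d + n * (b * c)) * (e * h + n * (f * g))
        ≡ a * d * (e * h) + n * n * (b * c * (f * g)) + n * (a * d * (f * g) + b * c * (e * h))
    expand = solve 9 (λ n a b c d e f g h →
      (a :* d :+ n :* (b :* c)) :* (e :* h :+ n :* (f :* g))
        := a :* d :* (e :* h) :+ n :* n :* (b :* c :* (f :* g))
           :+ n :* (a :* d :* (f :* g) :+ b :* c :* (e :* h))) refl

  det-⊗ : (A B : Matrix₂ N) → det (A ⊗ B) ≡ det A * det B
  det-⊗ ⟦ a , b ︔ c , d ⟧ ⟦ e , f ︔ g , h ⟧ = begin
    p - q                            ≡⟨ cong (p +_) (-1*x≈-x q) ⟨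
    p + n * q                        ≡⟨ product n a b c d e f g h ⟩
    (s + t + u) + (1# + n) * v       ≡⟨ cong (λ k → (s + t + u) + k * v) (-‿inverseʳ 1#) ⟩
    (s + t + u) + 0# * v             ≡⟨ cong ((s + t + u) +_) (R.zeroˡ v) ⟩
    (s + t + u) + 0#                 ≡⟨ +-identityʳ _ ⟩
    s + t + u                        ≡⟨ cong (λ k → s + k + u) (*-identityˡ t) ⟨
    s + 1# * t + u                   ≡⟨ cong (λ k → s + k * t + u) n*n≡1 ⟨
    s + n * n * t + u                ≡⟨ expand n a b c d e f g h ⟨
    (a * d + n * (b * c)) * (e * h + n * (f * g))
      ≡⟨ cong₂ (λ x y → (a * d + x) * (e * h + y)) (-1*x≈-x (b * c)) (-1*x≈-x (f * g)) ⟩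
    (a * d - b * c) * (e * h - f * g) ∎
    where
    open ≡-Reasoning
    n p q s t u v : ℤ/ N
    n = - 1#
    p = (a * e + b * g) * (c * f + d * h)
    q = (a * f + b * h) * (c * e + d * g)
    s = a * d * (e * h)
    t = b * c * (f * g)
    u = n * (a * d * (f * g) + b * c * (e * h))
    v = a * e * (c * f) + b * g * (d * h)
    n*n≡1 : n * n ≡ 1#
    n*n≡1 = trans (-1*x≈-x n) (-‿involutive 1#)

  infixl 7 _∙_
  _∙_ : SL₂ N → SL₂ N → SL₂ N
  (A , det-A) ∙ (B , det-B) =
    A ⊗ B , trans (det-⊗ A B) (trans (cong₂ _*_ det-A det-B) (*-identityˡ 1#))

  ident : SL₂ N
  ident = Id , (begin
    1# * 1# - 0# * 0#  ≡⟨ cong₂ _-_ (*-identityˡ 1#) (R.zeroˡ 0#) ⟩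
    1# - 0#            ≡⟨ cong (_- 0#) (+-identityʳ 1#) ⟨
    (1# + 0#) - 0#     ≡⟨ +-assoc 1# 0# (- 0#) ⟩
    1# + (0# - 0#)     ≡⟨ cong (1# +_) (-‿inverseʳ 0#) ⟩
    1# + 0#            ≡⟨ +-identityʳ 1# ⟩
    1#                 ∎)
    where open ≡-Reasoning

  letter : ℤ/ N → SL₂ N
  letter α = ⟦ 0# , 1# ︔ - 1# , α ⟧ , (begin
    0# * α - 1# * - 1#  ≡⟨ cong₂ _-_ (R.zeroˡ α) (*-identityˡ (- 1#)) ⟩
    0# - - 1#           ≡⟨ +-identityˡ _ ⟩
    - - 1#              ≡⟨ -‿involutive 1# ⟩
    1#                  ∎)
    where open ≡-Reasoning

  infixr 8 _▷_
  _▷_ : SL₂ N → Vector₂ N → Vector₂ N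
  (⟦ a , b ︔ c , d ⟧ , _) ▷ (x , y) = a * x + b * y , c * x + d * y

  𝟎 e₁ e₂ : Vector₂ N
  𝟎  = 0# , 0#
  e₁ = 1# , 0#
  e₂ = 0# , 1#

  infixr 7 _·_
  _·_ : ℤ/ N → Vector₂ N → Vector₂ N
  k · (x , y) = k * x , k * y

  IsUnit : Pred (ℤ/ N) 0ℓ
  IsUnit = Invertible _≡_ 1# _*_

  -- A relation on nonzero vectors only.  This matters when N = 1: there
  -- are then no classes at all, so no two vectors are related.
  infix 4 _∼′_
  _∼′_ : Vector₂ N → Vector₂ N → Set
  u ∼′ v = u ≢ 𝟎 × v ≢ 𝟎 × ∃[ k ] (k ∈ IsUnit × u ≡ k · v)

Word : ℕ → Set
Word N = List (ℤ/ N)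

module _ {N : ℕ} .{{_ : NonZero N}} where

  π : Word N → SL₂ N
  π w = foldr _∙_ ident (map letter w)

  F^ : ℕ → Pred (Word N) 0ℓ
  F^ l w = length w ≡ l

  𝓐̄ 𝓒̄ : Pred (Word N) 0ℓ
  𝓐̄ w = π w ▷ e₂ ∼′ e₁
  𝓒̄ = ∁ 𝓐̄

  𝓐̄^ 𝓒̄^ : ℕ → Pred (Word N) 0ℓ
  𝓐̄^ l = F^ l ∩ 𝓐̄
  𝓒̄^ l = F^ l ∩ 𝓒̄

  𝓟^ : ℕ → Pred (Word N) 0ℓ
  𝓟^ l w = w ∈ 𝓐̄^ l × (∀ h → 1 ℕ.≤ h → h ℕ.< l → take h w ∈ 𝓒̄^ h)

  𝓟 : Pred (Word N) 0ℓ
  𝓟 = ⋃ ℕ 𝓟^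

-- The data n, (p₁, …, pₙ₊₁), (δ₁, …, δₙ).
Factorization : ℕ → Set
Factorization N = Σ[ n ∈ ℕ ] (Vec (Word N) (suc n) × Vec (ℤ/ N) n)

-- p₁ δ₁ p₂ δ₂ ⋯ pₙ δₙ pₙ₊₁
interleave : ∀ {N n} → Vec (Word N) (suc n) → Vec (ℤ/ N) n → Word N
interleave (p ∷ [])  []       = p
interleave (p ∷ ps)  (δ ∷ δs) = p ++ δ ∷ interleave ps δs

infix 4 _Factors_
_Factors_ : ∀ {N} .{{_ : NonZero N}} → Factorization N → Word N → Set
(_ , ps , δs) Factors w = All 𝓟 ps × w ≡ interleave ps δs

{-# OPTIONS --safe #-}

-- Since π(w) has determinant 1, w lies in 𝓐̄ exactly when 1 ≠ 0 and the lower
-- right entry of π(w) vanishes; in that case the lower left entry is a unit.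
-- As π(δ) sends (x , y) to (y , δy - x), it follows that, for u in 𝓐̄, the word
-- u δ v lies in 𝓐̄ if and only if v does.  Hence p₁ must be the shortest prefix
-- of w in 𝓐̄, and the remaining factors come from what follows p₁ δ₁.
module Submission where

open import Defs
open import Algebra.Bundles using (CommutativeRing)
import Data.Fin.Properties as Fin
open import Data.List.Base using (List; []; _∷_; _++_; length; take)
open import Data.List.Properties
  using (++-identityʳ; length-take; length-++; ∷-injective)
open import Data.Nat.Base as ℕ using (ℕ; zero; suc; NonZero; z≤n; s≤s)
open import Data.Nat.Induction using (<-wellFounded)
import Data.Nat.Properties as ℕ
open import Data.Product
  using (∃-syntax; ∃₂; ∃!; _×_; _,_; proj₁; proj₂)
open import Data.Vec.Base using (Vec; []; _∷_)
open import Data.Vec.Relation.Unary.All using (All; []; _∷_)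
open import Function.Base using (_∘_)
open import Function.Bundles using (_⇔_; mk⇔)
open import Induction.WellFounded using (Acc; acc)
open import Level using (Level)
open import Relation.Binary.PropositionalEquality
open import Relation.Nullary using (¬_; yes; no; contradiction)
open import Relation.Nullary.Decidable using (map′; ¬?; _×-dec_)
open import Relation.Unary using (Pred; Decidable; _∈_; _∉_)

module _ {a p : Level} {A : Set a} where

  -- Each letter stepped over is absorbed into the predicate, so only the empty prefix is ever
  -- tested. The search stops at `w` itself at the latest, where `w ∈ P` applies.
  shortest-prefix : {P : Pred (List A) p} → Decidable P → ∀ w → w ∈ P →
    ∃₂ λ u s → u ++ s ≡ w × u ∈ P × (∀ h → h ℕ.< length u → take h u ∉ P)
  shortest-prefix P? w w∈P with P? []
  shortest-prefix P? w w∈P       | yes []∈P = [] , w , refl , []∈P , λ _ ()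
  shortest-prefix P? [] w∈P      | no  []∉P = contradiction w∈P []∉P
  shortest-prefix P? (x ∷ w) w∈P | no  []∉P =
    let u , s , u++s≡w , xu∈P , shorter∉P = shortest-prefix (P? ∘ (x ∷_)) w w∈P
    in x ∷ u , s , cong (x ∷_) u++s≡w , xu∈P ,
       λ { zero _ → []∉P ; (suc h) (s≤s h<) → shorter∉P h h< }

module _ {a : Level} {A : Set a} where

  take-prefix : ∀ (u v : List A) {s t} → u ++ s ≡ v ++ t →
    length u ℕ.≤ length v → take (length u) v ≡ u
  take-prefix []      v       eq _         = refl
  take-prefix (x ∷ u) (y ∷ v) eq (s≤s ∣u∣≤∣v∣) =
    let x≡y , eq′ = ∷-injective eq
    in cong₂ _∷_ (sym x≡y) (take-prefix u v eq′ ∣u∣≤∣v∣)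

  ++-injective : ∀ (u v : List A) {s t} → u ++ s ≡ v ++ t →
    length u ≡ length v → u ≡ v × s ≡ t
  ++-injective []      []      eq _   = refl , eq
  ++-injective (x ∷ u) (y ∷ v) eq ∣u∣≡∣v∣ =
    let x≡y , eq′ = ∷-injective eq
        u≡v , s≡t = ++-injective u v eq′ (ℕ.suc-injective ∣u∣≡∣v∣)
    in cong₂ _∷_ x≡y u≡v , s≡t

module _ {N : ℕ} .{{_ : NonZero N}} where

  private
    module R = CommutativeRing (ℤ/-commutativeRing N)
    open import Algebra.Properties.Ring R.ring using (-‿distribˡ-*; -‿distribʳ-*)
    import Algebra.Solver.Ring.NaturalCoefficients.Default R.commutativeSemiring as S
    open S using (solve; _:+_; _:*_; _:=_)

  ∙-▷ : (A B : SL₂ N) (v : Vector₂ N) → (A ∙ B) ▷ v ≡ A ▷ B ▷ v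
  ∙-▷ (⟦ a , b ︔ c , d ⟧ , _) (⟦ e , f ︔ g , h ⟧ , _) (x , y) =
    cong₂ _,_ (row a b e f g h x y) (row c d e f g h x y)
    where
    row : ∀ a b e f g h x y →
      (a * e + b * g) * x + (a * f + b * h) * y ≡ a * (e * x + f * y) + b * (g * x + h * y)
    row = solve 8 (λ a b e f g h x y →
      (a :* e :+ b :* g) :* x :+ (a :* f :+ b :* h) :* y
        := a :* (e :* x :+ f :* y) :+ b :* (g :* x :+ h :* y)) refl

  ident-▷ : (v : Vector₂ N) → ident ▷ v ≡ v
  ident-▷ (x , y) = cong₂ _,_
    (trans (cong₂ _+_ (*-identityˡ x) (R.zeroˡ y)) (+-identityʳ x))
    (trans (cong₂ _+_ (R.zeroˡ x) (*-identityˡ y)) (+-identityˡ y))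

  π-++-▷ : ∀ u w (v : Vector₂ N) → π (u ++ w) ▷ v ≡ π u ▷ π w ▷ v
  π-++-▷ []      w v = sym (ident-▷ _)
  π-++-▷ (α ∷ u) w v = begin
    (letter α ∙ π (u ++ w)) ▷ v    ≡⟨ ∙-▷ (letter α) (π (u ++ w)) v ⟩
    letter α ▷ π (u ++ w) ▷ v      ≡⟨ cong (letter α ▷_) (π-++-▷ u w v) ⟩
    letter α ▷ π u ▷ π w ▷ v       ≡⟨ ∙-▷ (letter α) (π u) _ ⟨
    (letter α ∙ π u) ▷ π w ▷ v     ∎
    where open ≡-Reasoning

  letter-▷₁ : ∀ α (v : Vector₂ N) → proj₁ (letter α ▷ v) ≡ proj₂ v
  letter-▷₁ α (x , y) =
    trans (cong₂ _+_ (R.zeroˡ x) (*-identityˡ y)) (+-identityˡ y)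

  ▷e₂ : (A : SL₂ N) → A ▷ e₂ ≡ (Matrix₂.m₁₂ (proj₁ A) , Matrix₂.m₂₂ (proj₁ A))
  ▷e₂ (⟦ a , b ︔ c , d ⟧ , _) = cong₂ _,_ (row a b) (row c d)
    where
    row : ∀ a b → a * 0# + b * 1# ≡ b
    row a b = trans (cong₂ _+_ (R.zeroʳ a) (*-identityʳ b)) (+-identityˡ b)

  ·e₁ : ∀ k → k · e₁ ≡ (k , 0#)
  ·e₁ k = cong₂ _,_ (*-identityʳ k) (R.zeroʳ k)

  -- With `d` zero the determinant reduces to `- (b * c)`. This gives `b` and `c` explicit inverses:
  -- `b` becomes the scalar required by `∼′`, and `c` is cancelled in `𝓐̄-++⁻`.
  m₂₂≡0⇒-m₁₂m₂₁≡1 : ((⟦ a , b ︔ c , d ⟧ , _) : SL₂ N) → d ≡ 0# → - b * c ≡ 1#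
  m₂₂≡0⇒-m₁₂m₂₁≡1 (⟦ a , b ︔ c , d ⟧ , det≡1) d≡0 = begin
    - b * c          ≡⟨ -‿distribˡ-* b c ⟨
    - (b * c)        ≡⟨ +-identityˡ _ ⟨
    0# - b * c       ≡⟨ cong (_- b * c) (R.zeroʳ a) ⟨
    a * 0# - b * c   ≡⟨ cong (λ k → a * k - b * c) d≡0 ⟨
    a * d - b * c    ≡⟨ det≡1 ⟩
    1#               ∎
    where open ≡-Reasoning

  lowerRight : Word N → ℤ/ N
  lowerRight w = Matrix₂.m₂₂ (proj₁ (π w))

  proj₂-▷e₂ : ∀ w → proj₂ (π w ▷ e₂) ≡ lowerRight w
  proj₂-▷e₂ w = cong proj₂ (▷e₂ (π w))

  -- The inequality comes from the demand in `∼′` that `e₁` be nonzero; it excludes `N = 1`, where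
  -- `𝓐̄` is empty.
  ∈𝓐̄⇒ : ∀ w → w ∈ 𝓐̄ → 1# {N} ≢ 0# × lowerRight w ≡ 0#
  ∈𝓐̄⇒ w (_ , e₁≢𝟎 , k , _ , eq) =
    (λ 1≡0 → e₁≢𝟎 (cong (_, 0#) 1≡0)) ,
    cong proj₂ (trans (sym (▷e₂ (π w))) (trans eq (·e₁ k)))

  ∈𝓐̄⇐ : ∀ w → 1# {N} ≢ 0# → lowerRight w ≡ 0# → w ∈ 𝓐̄
  ∈𝓐̄⇐ w 1≢0 d≡0 =
    -- The second column of `π w` is `(b , 0#)`, so the scalar is `b`, with inverse `- c`.
    ▷e₂≢𝟎 , (1≢0 ∘ cong proj₁) , b ,
    (- c , trans (*-comm (- c) b) b*-c≡1 , b*-c≡1) ,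
    trans (▷e₂ (π w)) (trans (cong (b ,_) d≡0) (sym (·e₁ b)))
    where
    b = Matrix₂.m₁₂ (proj₁ (π w))
    c = Matrix₂.m₂₁ (proj₁ (π w))
    b*-c≡1 : b * - c ≡ 1#
    b*-c≡1 = trans (sym (-‿distribʳ-* b c))
      (trans (-‿distribˡ-* b c) (m₂₂≡0⇒-m₁₂m₂₁≡1 (π w) d≡0))
    ▷e₂≢𝟎 : π w ▷ e₂ ≢ 𝟎
    ▷e₂≢𝟎 eq = 1≢0 (begin
      1#        ≡⟨ b*-c≡1 ⟨
      b * - c   ≡⟨ cong (_* - c) (cong proj₁ (trans (sym (▷e₂ (π w))) eq)) ⟩
      0# * - c  ≡⟨ R.zeroˡ (- c) ⟩
      0#        ∎)
      where open ≡-Reasoning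

  -- The criterion by entries replaces the search for a unit scalar by two equality tests on
  -- residues. `shortest-prefix` runs on this test.
  _∈𝓐̄? : Decidable {A = Word N} 𝓐̄
  w ∈𝓐̄? = map′ (λ (1≢0 , d≡0) → ∈𝓐̄⇐ w 1≢0 d≡0) (∈𝓐̄⇒ w)
    (¬? (1# Fin.≟ 0#) ×-dec (lowerRight w Fin.≟ 0#))

  -- The lower right entry of the identity matrix is `1#`. This case is treated apart because `𝓟^`
  -- constrains only prefixes of length at least 1.
  []∉𝓐̄ : [] ∉ 𝓐̄ {N}
  []∉𝓐̄ []∈𝓐̄ = let 1≢0 , 1≡0 = ∈𝓐̄⇒ [] []∈𝓐̄ in 1≢0 1≡0

  -- The lower row of `π u` is `(c , 0#)`, so it sees only a first coordinate, and `letter δ` has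
  -- moved the second coordinate of `π v ▷ e₂` there. Hence `δ` drops out.
  lowerRight-++ : ∀ u δ v → lowerRight u ≡ 0# →
    lowerRight (u ++ δ ∷ v) ≡ Matrix₂.m₂₁ (proj₁ (π u)) * lowerRight v
  lowerRight-++ u δ v d≡0 = begin
    lowerRight (u ++ δ ∷ v)              ≡⟨ proj₂-▷e₂ (u ++ δ ∷ v) ⟨
    proj₂ (π (u ++ δ ∷ v) ▷ e₂)          ≡⟨ cong proj₂ (π-++-▷ u (δ ∷ v) e₂) ⟩
    c * proj₁ x + d * proj₂ x            ≡⟨ cong (λ k → c * proj₁ x + k * proj₂ x) d≡0 ⟩
    c * proj₁ x + 0# * proj₂ x           ≡⟨ cong (c * proj₁ x +_) (R.zeroˡ (proj₂ x)) ⟩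
    c * proj₁ x + 0#                     ≡⟨ +-identityʳ _ ⟩
    c * proj₁ x                          ≡⟨ cong (λ y → c * proj₁ y) (∙-▷ (letter δ) (π v) e₂) ⟩
    c * proj₁ (letter δ ▷ π v ▷ e₂)      ≡⟨ cong (c *_) (letter-▷₁ δ (π v ▷ e₂)) ⟩
    c * proj₂ (π v ▷ e₂)                 ≡⟨ cong (c *_) (proj₂-▷e₂ v) ⟩
    c * lowerRight v                     ∎
    where
    open ≡-Reasoning
    c = Matrix₂.m₂₁ (proj₁ (π u))
    d = lowerRight u
    x = π (δ ∷ v) ▷ e₂

  𝓐̄-++⁺ : ∀ u δ v → u ∈ 𝓐̄ → v ∈ 𝓐̄ → u ++ δ ∷ v ∈ 𝓐̄
  𝓐̄-++⁺ u δ v u∈𝓐̄ v∈𝓐̄ =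
    let 1≢0 , u≡0 = ∈𝓐̄⇒ u u∈𝓐̄
        _   , v≡0 = ∈𝓐̄⇒ v v∈𝓐̄
    in ∈𝓐̄⇐ (u ++ δ ∷ v) 1≢0
         (trans (lowerRight-++ u δ v u≡0) (trans (cong (c *_) v≡0) (R.zeroʳ c)))
    where c = Matrix₂.m₂₁ (proj₁ (π u))

  𝓐̄-++⁻ : ∀ u δ v → u ∈ 𝓐̄ → u ++ δ ∷ v ∈ 𝓐̄ → v ∈ 𝓐̄
  𝓐̄-++⁻ u δ v u∈𝓐̄ uδv∈𝓐̄ = ∈𝓐̄⇐ v 1≢0 (begin
    lowerRight v                   ≡⟨ *-identityˡ _ ⟨
    -- Multiplying by `- b`, the inverse of `c`, undoes the factor from `lowerRight-++`.
    1# * lowerRight v              ≡⟨ cong (_* lowerRight v) (m₂₂≡0⇒-m₁₂m₂₁≡1 (π u) u≡0) ⟨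
    - b * c * lowerRight v         ≡⟨ *-assoc (- b) c _ ⟩
    - b * (c * lowerRight v)       ≡⟨ cong (- b *_) (lowerRight-++ u δ v u≡0) ⟨
    - b * lowerRight (u ++ δ ∷ v)  ≡⟨ cong (- b *_) (proj₂ (∈𝓐̄⇒ (u ++ δ ∷ v) uδv∈𝓐̄)) ⟩
    - b * 0#                       ≡⟨ R.zeroʳ (- b) ⟩
    0#                             ∎)
    where
    open ≡-Reasoning
    1≢0 = proj₁ (∈𝓐̄⇒ u u∈𝓐̄)
    u≡0 = proj₂ (∈𝓐̄⇒ u u∈𝓐̄)
    b = Matrix₂.m₁₂ (proj₁ (π u))
    c = Matrix₂.m₂₁ (proj₁ (π u))

  𝓟⊆𝓐̄ : ∀ p → p ∈ 𝓟 → p ∈ 𝓐̄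
  𝓟⊆𝓐̄ p (_ , (_ , p∈𝓐̄) , _) = p∈𝓐̄

  𝓐̄-prefix : ∀ w → w ∈ 𝓐̄ → ∃₂ λ p s → p ++ s ≡ w × p ∈ 𝓟
  𝓐̄-prefix w w∈𝓐̄ =
    let p , s , eq , p∈𝓐̄ , shorter∉𝓐̄ = shortest-prefix _∈𝓐̄? w w∈𝓐̄
    in p , s , eq , length p , (refl , p∈𝓐̄) , λ h _ h< →
         trans (length-take h p) (ℕ.m≤n⇒m⊓n≡m (ℕ.<⇒≤ h<)) , shorter∉𝓐̄ h h<

  -- A shorter `p` would be a proper prefix of `q` lying in `𝓐̄`, which `q ∈ 𝓟` forbids.
  𝓟-prefix-≮ : ∀ p q {s t} → p ∈ 𝓟 → q ∈ 𝓟 → p ++ s ≡ q ++ t →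
    ¬ length p ℕ.< length q
  𝓟-prefix-≮ []          _ p∈𝓟 _ _ _ = []∉𝓐̄ (𝓟⊆𝓐̄ [] p∈𝓟)
  𝓟-prefix-≮ p@(_ ∷ _) q p∈𝓟 (_ , (refl , _) , shorter∈𝓒̄) eq p<q =
    proj₂ (shorter∈𝓒̄ (length p) (s≤s z≤n) p<q)
      (subst 𝓐̄ (sym (take-prefix p q eq (ℕ.<⇒≤ p<q))) (𝓟⊆𝓐̄ p p∈𝓟))

  -- `𝓟` is a prefix code: neither word can be shorter than the other, so both cuts fall at the same
  -- place. Uniqueness of factorizations rests on this.
  𝓟-prefix-unique : ∀ p q {s t} → p ∈ 𝓟 → q ∈ 𝓟 → p ++ s ≡ q ++ t →
    p ≡ q × s ≡ t
  𝓟-prefix-unique p q p∈𝓟 q∈𝓟 eq = ++-injective p q eq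
    (ℕ.≤-antisym (ℕ.≮⇒≥ (𝓟-prefix-≮ q p q∈𝓟 p∈𝓟 (sym eq)))
                 (ℕ.≮⇒≥ (𝓟-prefix-≮ p q p∈𝓟 q∈𝓟 eq)))

  interleave∈𝓐̄ : ∀ {n} (ps : Vec (Word N) (suc n)) δs → All 𝓟 ps →
    interleave ps δs ∈ 𝓐̄
  interleave∈𝓐̄ (p ∷ [])     []       (p∈𝓟 ∷ _)    = 𝓟⊆𝓐̄ p p∈𝓟
  interleave∈𝓐̄ (p ∷ q ∷ ps) (δ ∷ δs) (p∈𝓟 ∷ ps∈𝓟) =
    𝓐̄-++⁺ p δ (interleave (q ∷ ps) δs) (𝓟⊆𝓐̄ p p∈𝓟)
      (interleave∈𝓐̄ (q ∷ ps) δs ps∈𝓟)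

  -- `interleave` inspects the tail of its first vector, so the equation computes only once `ps` is
  -- exposed as a cons.
  interleave-∷ : ∀ {n} p (ps : Vec (Word N) (suc n)) δ δs →
    interleave (p ∷ ps) (δ ∷ δs) ≡ p ++ δ ∷ interleave ps δs
  interleave-∷ p (_ ∷ _) δ δs = refl

  -- The word left after `p ++ δ ∷ []` is not a structural subterm of `w`, hence the recursion on
  -- length.
  factor : ∀ w → Acc ℕ._<_ (length w) → w ∈ 𝓐̄ → ∃[ φ ] φ Factors w
  factor w (acc rec) w∈𝓐̄ =
    let p , s , p++s≡w , p∈𝓟 = 𝓐̄-prefix w w∈𝓐̄ in extend p s p++s≡w p∈𝓟
    where
    v<w : ∀ p {δ v} → p ++ δ ∷ v ≡ w → length v ℕ.< length w
    -- The letter `δ` alone makes the decrease strict, whatever the length of `p`.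
    v<w p {_} {v} eq = subst (length v ℕ.<_) (trans (sym (length-++ p)) (cong length eq))
      (ℕ.m≤n+m _ (length p))

    extend : ∀ p s → p ++ s ≡ w → p ∈ 𝓟 → ∃[ φ ] φ Factors w
    extend p []      eq p∈𝓟 =
      (0 , p ∷ [] , []) , p∈𝓟 ∷ [] , trans (sym eq) (++-identityʳ p)
    extend p (δ ∷ v) eq p∈𝓟 =
      let v∈𝓐̄ = 𝓐̄-++⁻ p δ v (𝓟⊆𝓐̄ p p∈𝓟) (subst 𝓐̄ (sym eq) w∈𝓐̄)
          (n , ps , δs) , ps∈𝓟 , v≡ = factor v (rec (v<w p eq)) v∈𝓐̄
      in (suc n , p ∷ ps , δ ∷ δs) , p∈𝓟 ∷ ps∈𝓟 ,
         trans (sym eq) (trans (cong (λ v → p ++ δ ∷ v) v≡) (sym (interleave-∷ p ps δ δs)))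

  -- The prefix code property is applied to the first factors, then to the rest. The numbers of
  -- factors may differ a priori, so the equality is one of whole triples.
  interleave-injective : ∀ {m n} (ps : Vec (Word N) (suc m)) (qs : Vec (Word N) (suc n)) δs εs →
    All 𝓟 ps → All 𝓟 qs → interleave ps δs ≡ interleave qs εs →
    _≡_ {A = Factorization N} (m , ps , δs) (n , qs , εs)
  interleave-injective (p ∷ []) (q ∷ []) [] [] (p∈𝓟 ∷ _) (q∈𝓟 ∷ _) eq =
    cong (λ p → 0 , p ∷ [] , []) (proj₁ (𝓟-prefix-unique p q p∈𝓟 q∈𝓟 (cong (_++ []) eq)))
  -- Here and in the mirror case the first factors agree, and an empty remainder would equal one
  -- starting with a letter.
  interleave-injective (p ∷ []) (q ∷ _ ∷ _) [] (_ ∷ _) (p∈𝓟 ∷ _) (q∈𝓟 ∷ _) eq =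
    contradiction (proj₂ (𝓟-prefix-unique p q p∈𝓟 q∈𝓟 (trans (++-identityʳ p) eq))) λ ()
  interleave-injective (p ∷ _ ∷ _) (q ∷ []) (_ ∷ _) [] (p∈𝓟 ∷ _) (q∈𝓟 ∷ _) eq =
    contradiction (proj₂ (𝓟-prefix-unique p q p∈𝓟 q∈𝓟 (trans eq (sym (++-identityʳ q))))) λ ()
  interleave-injective (p ∷ ps@(_ ∷ _)) (q ∷ qs@(_ ∷ _)) (δ ∷ δs) (ε ∷ εs)
    (p∈𝓟 ∷ ps∈𝓟) (q∈𝓟 ∷ qs∈𝓟) eq =
    let p≡q , eq′ = 𝓟-prefix-unique p q p∈𝓟 q∈𝓟 eq
        δ≡ε , eq″ = ∷-injective eq′
    in prepend p≡q δ≡ε (interleave-injective ps qs δs εs ps∈𝓟 qs∈𝓟 eq″)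
    where
    -- Matching on an equality of triples identifies the lengths together with the vectors indexed
    -- by them.
    prepend : ∀ {p q δ ε} {φ ψ : Factorization N} → p ≡ q → δ ≡ ε → φ ≡ ψ →
      let n , ps , δs = φ ; m , qs , εs = ψ in
      _≡_ {A = Factorization N} (suc n , p ∷ ps , δ ∷ δs) (suc m , q ∷ qs , ε ∷ εs)
    prepend refl refl refl = refl

theorem5p2 : (N : ℕ) .{{_ : NonZero N}} (w : Word N) →
    ((w ∈ 𝓐̄) ⇔ (∃[ φ ] φ Factors w)) ×
    (w ∈ 𝓐̄ → ∃! _≡_ (λ φ → φ Factors w))
theorem5p2 N w =
  mk⇔ factorization (λ { ((_ , ps , δs) , ps∈𝓟 , refl) → interleave∈𝓐̄ ps δs ps∈𝓟 }) ,
  λ w∈𝓐̄ → let φ@(_ , ps , δs) , ps∈𝓟 , w≡ = factorization w∈𝓐̄ in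
    φ , (ps∈𝓟 , w≡) , λ { {_ , qs , εs} (qs∈𝓟 , w≡′) →
      interleave-injective ps qs δs εs ps∈𝓟 qs∈𝓟 (trans (sym w≡) w≡′) }
  where
  factorization : w ∈ 𝓐̄ → ∃[ φ ] φ Factors w
  factorization = factor w (<-wellFounded (length w))
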